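{- Let $\kappa\leq\lambda$ be infinite cardinals with $\kappa$ regular, and assume $\lambda^{<\kappa}=\lambda\geq\mathfrak{c}=2^{\aleph_0}$. Then there is no continuous weak $\lambda^+$-measure space $({}^{\kappa}\lambda,\mathfrak{M},\mu)$ on ${}^{\kappa}\lambda$ (for any choice of positively totally ordered monoid $\mathbb{S}$ with infinitary sum $\mathsf{Sum}$ in which $\mu$ takes its values).
   Context: **Topology.** ${}^{\kappa}\lambda$ is the set of sequences of elements of $\lambda$ of length $\kappa$, with the bounded topology, generated by the cones $\mathbf{N}_s=\{x\in{}^{\kappa}\lambda\mid s\subseteq x\}$ for $s\in{}^{<\kappa}\lambda=\bigcup_{\alpha<\kappa}{}^{\alpha}\lambda$. **Monoids and sums.** A positively totally ordered monoid is $\mathbb{S}=(S,0,+,\leq)$ where $+$ is associative (not necessarily commutative) with neutral element $0$, $\leq$ is a total order, $a\leq b$ and $c\leq d$ imply $a+c\leq b+d$, $0$ is the minimum of $\leq$, and $S\neq\{0\}$. ${}^{<\mathrm{On}}\mathbb{S}$ is the class of all sequences of elements of $S$ of ordinal length; $\mathrm{lh}(s)$ is the length of $s$. An infinitary sum on $\mathbb{S}$ is a partial function $\mathsf{Sum}:{}^{<\mathrm{On}}\mathbb{S}\to\mathbb{S}$ such that: (S1) $\mathsf{Sum}(\emptyset)=0$ and $\mathsf{Sum}(s)=s_0+\dots+s_n$ for every non-empty finite $s=(s_i)_{i\leq n}\in\mathrm{dom}(\mathsf{Sum})$; (S2) (continuity) for all $s\in\mathrm{dom}(\mathsf{Sum})$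 of limit length, if $s\restriction\alpha\in\mathrm{dom}(\mathsf{Sum})$ for cofinally many $\alpha<\mathrm{lh}(s)$, then $\mathsf{Sum}(s)=\sup\{\mathsf{Sum}(s\restriction\alpha)\mid\alpha<\mathrm{lh}(s),\ s\restriction\alpha\in\mathrm{dom}(\mathsf{Sum})\}$. **Measures.** A weakly $\lambda^+$-measurable space is a pair $(X,\mathfrak{M})$ where $X$ is a topological space and $\mathfrak{M}$ is a family of subsets of $X$ closed under unions of size $\leq\lambda$ and containing all open subsets of $X$. A $\lambda^+$-measure on it (with values in $(\mathbb{S},\mathsf{Sum})$) is a partial function $\mu:\mathscr{P}(X)\to\mathbb{S}$ with $\mathfrak{M}\subseteq\mathrm{dom}(\mu)$ such that: (M1) $\mu(\emptyset)=0$; (M2) $\mu(X)>0$; (M3) $A\subseteq B$ implies $\mu(A)\leq\mu(B)$ for all $A,B\in\mathfrak{M}$; (M4) for every family $(A_i)_{i<\gamma}$ of pairwise disjoint sets of $\mathfrak{M}$ of length an ordinal $\gamma<\lambda^+$, we have $\langle\mu(A_i)\mid i<\gamma\rangle\in\mathrm{dom}(\mathsf{Sum})$ and $\mu(\bigcup_{i<\gamma}A_i)=\mathsf{Sum}(\langle\mu(A_i)\mid i<\gamma\rangle)$; (M5) for every $x\in X$ with $\{x\}\in\mathfrak{M}$ and every open local basis $\{A_i\mid i<\gamma\}$ at $x$ with $\gamma<\lambda^+$, $\mu(\{x\})=\inf_{i<\gamma}\mu(A_i)$. Then $(X,\mathfrak{M},\mu)$ is called a weak $\lambda^+$-measure space.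 It is continuous if $\{x\}\in\mathfrak{M}$ and $\mu(\{x\})=0$ for every $x\in X$. -}

module Defs where

open import Algebra.Bundles using (RawMonoid)
open import Algebra.Definitions.RawMonoid using (sum)
open import Algebra.Structures using (IsMonoid)
import Data.Empty.Polymorphic as Empty
open import Data.Fin.Base using (Fin)
import Data.Fin.Base as Fin
open import Data.Nat.Base using (ℕ)
import Data.Nat.Base as ℕ
open import Data.Product.Base using (Σ-syntax; ∃-syntax; _×_; _,_; proj₁)
open import Data.Refinement using (Refinement; Refinement-syntax; value)
open import Data.Sum.Base using (_⊎_)
open import Function.Base using (_∘_; _on_)
open import Function.Bundles using (_↣_; _⤖_; mk↣)
open import Induction.WellFounded using (WellFounded)
open import Level using (Level; _⊔_; suc)
open import Relation.Binary.Core using (Rel; _Preserves₂_⟶_⟶_)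
open import Relation.Binary.Definitions
  using (Minimum; Trichotomous; tri<; tri≈; tri>; _Respects_)
import Relation.Binary.Construct.On as On
open import Relation.Binary.Morphism.Structures using (IsOrderIsomorphism)
open import Relation.Binary.PropositionalEquality
  using (_≡_; refl; cong; isEquivalence; resp₂)
open import Relation.Binary.Structures using (IsTotalOrder; IsStrictTotalOrder)
open import Relation.Nullary.Negation using (¬_)
open import Relation.Unary using (Pred; _∈_; _⊆_; _≐_; _∩_; _⊥_; ⋃; ｛_｝)
open import Relation.Unary.Polymorphic using (∅; U)

private
  variable
    u a b ℓ ℓ₁ ℓ₂ : Level

-- Sets are types in Set u, subsets of X are predicates in Pred X u taken up to _≐_,
-- and ordinals are well-orders on such types taken up to order isomorphism.
-- Collections of subsets or of sequences live at level suc u; under excluded middle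
-- the choice of that level is immaterial.

record Ordinal (u : Level) : Set (suc u) where
  infix 4 _<_ _≤_
  field
    Carrier            : Set u
    _<_                : Rel Carrier u
    isStrictTotalOrder : IsStrictTotalOrder _≡_ _<_
    wellFounded        : WellFounded _<_

  open IsStrictTotalOrder isStrictTotalOrder public
    using (compare; irrefl; trans; asym)

  _≤_ : Rel Carrier u
  α ≤ β = α < β ⊎ α ≡ β

∣_∣ : Ordinal u → Set u
∣ Γ ∣ = Ordinal.Carrier Γ

-- Γ ↾ α is the ordinal α, as the initial segment of the elements of Γ below α.
-- The bound is kept as an irrelevant proof, so an element of the segment is
-- determined by its underlying element of Γ.

infixl 8 _↾_

_↾_ : (Γ : Ordinal u) → ∣ Γ ∣ → Ordinal u
_↾_ {u} Γ α = record
  { Carrier            = Segment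
  ; _<_                = _≺_
  ; isStrictTotalOrder = record
    { isStrictPartialOrder = record
      { isEquivalence = isEquivalence
      ; irrefl        = λ { refl → irrefl refl }
      ; trans         = trans
      ; <-resp-≈      = resp₂ _≺_
      }
    ; compare = compare′
    }
  ; wellFounded = On.wellFounded value wellFounded
  }
  where
  open Ordinal Γ

  Segment : Set u
  Segment = [ β ∈ Carrier ∣ β < α ]

  _≺_ : Rel Segment u
  _≺_ = _<_ on value

  value-injective : {β γ : Segment} → value β ≡ value γ → β ≡ γ
  value-injective refl = refl

  compare′ : Trichotomous _≡_ _≺_
  compare′ β γ with compare (value β) (value γ)
  ... | tri< β<γ β≢γ β≯γ = tri< β<γ (β≢γ ∘ cong value) β≯γ
  ... | tri≈ β≮γ β≡γ β≯γ = tri≈ β≮γ (value-injective β≡γ) β≯γ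
  ... | tri> β≮γ β≢γ β>γ = tri> β≮γ (β≢γ ∘ cong value) β>γ

IsLimit : Ordinal u → Set u
IsLimit Γ = Carrier × (∀ α → ∃[ β ] α < β)
  where open Ordinal Γ

Cofinal : {I : Set a} (Γ : Ordinal u) → (I → ∣ Γ ∣) → Set (a ⊔ u)
Cofinal Γ f = ∀ β → ∃[ i ] β ≤ f i
  where open Ordinal Γ

IsInfiniteCardinal : Ordinal u → Set u
IsInfiniteCardinal Γ = (ℕ ↣ ∣ Γ ∣) × (∀ α → ¬ (∣ Γ ↾ α ∣ ⤖ ∣ Γ ∣))

-- cof(Γ) = Γ

IsRegular : Ordinal u → Set u
IsRegular Γ = ∀ α (f : ∣ Γ ↾ α ∣ → ∣ Γ ∣) → ¬ Cofinal Γ f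

-- A partial function between sets presented as types with an equivalence.

record PartialFunction {A : Set a} {B : Set b} (_∼_ : Rel A ℓ₁) (_≈_ : Rel B ℓ₂)
                       (ℓ : Level) : Set (a ⊔ b ⊔ ℓ₁ ⊔ ℓ₂ ⊔ suc ℓ) where
  field
    dom      : Pred A ℓ
    dom-resp : dom Respects _∼_
    app      : ∀ x → x ∈ dom → B
    app-cong : ∀ {x y} (x∈ : x ∈ dom) (y∈ : y ∈ dom) → x ∼ y → app x x∈ ≈ app y y∈

record PositivelyTotallyOrderedMonoid (u : Level) : Set (suc u) where
  infix  4 _≈_ _≤_ _<_
  infixl 6 _+_
  field
    Carrier      : Set u
    _≈_          : Rel Carrier u
    _≤_          : Rel Carrier u
    _+_          : Carrier → Carrier → Carrier
    0#           : Carrier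
    isMonoid     : IsMonoid _≈_ _+_ 0#
    isTotalOrder : IsTotalOrder _≈_ _≤_
    +-mono-≤     : _+_ Preserves₂ _≤_ ⟶ _≤_ ⟶ _≤_
    0-minimum    : Minimum _≤_ 0#
    nontrivial   : ∃[ x ] ¬ (x ≈ 0#)

  rawMonoid : RawMonoid u u
  rawMonoid = record { Carrier = Carrier ; _≈_ = _≈_ ; _∙_ = _+_ ; ε = 0# }

  _<_ : Rel Carrier u
  x < y = x ≤ y × ¬ (x ≈ y)

  IsSup : {I : Set a} → (I → Carrier) → Carrier → Set (a ⊔ u)
  IsSup f x = (∀ i → f i ≤ x) × (∀ y → (∀ i → f i ≤ y) → x ≤ y)

  IsInf : {I : Set a} → (I → Carrier) → Carrier → Set (a ⊔ u)
  IsInf f x = (∀ i → x ≤ f i) × (∀ y → (∀ i → y ≤ f i) → y ≤ x)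

module _ (𝕊 : PositivelyTotallyOrderedMonoid u) where

  private module S = PositivelyTotallyOrderedMonoid 𝕊

  record OrdinalSequence : Set (suc u) where
    constructor ⟨_,_⟩
    field
      lh : Ordinal u
      at : ∣ lh ∣ → S.Carrier

  open OrdinalSequence

  -- Two sequences are the same when they agree along an order isomorphism of
  -- their lengths.

  _≅_ : Rel OrdinalSequence u
  s ≅ t = Σ[ e ∈ (∣ lh s ∣ → ∣ lh t ∣) ]
            IsOrderIsomorphism _≡_ _≡_ (Ordinal._<_ (lh s)) (Ordinal._<_ (lh t)) e
          × (∀ i → at s i S.≈ at t (e i))

  restrict : (s : OrdinalSequence) → ∣ lh s ∣ → OrdinalSequence
  restrict s α = ⟨ lh s ↾ α , at s ∘ value ⟩

  record InfinitarySum : Set (suc (suc u)) where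
    field
      partialFunction : PartialFunction _≅_ S._≈_ (suc u)

    open PartialFunction partialFunction public renaming (app to Sum)

    field
      Sum-empty : ∀ s → ¬ ∣ lh s ∣ → Σ[ s∈ ∈ s ∈ dom ] Sum s s∈ S.≈ S.0#

      -- e enumerates the finite sequence s in increasing order.
      Sum-finite : ∀ s (s∈ : s ∈ dom) n (e : Fin (ℕ.suc n) → ∣ lh s ∣) →
                   IsOrderIsomorphism _≡_ _≡_ Fin._<_ (Ordinal._<_ (lh s)) e →
                   Sum s s∈ S.≈ sum S.rawMonoid (at s ∘ e)

      Sum-continuous : ∀ s (s∈ : s ∈ dom) → IsLimit (lh s) →
        let Restriction∈dom = Σ[ α ∈ ∣ lh s ∣ ] restrict s α ∈ dom in
        Cofinal {I = Restriction∈dom} (lh s) (λ (α , _) → α) →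
        S.IsSup {I = Restriction∈dom} (λ (α , s↾α∈) → Sum (restrict s α) s↾α∈) (Sum s s∈)

record TopologicalSpace (u : Level) : Set (suc (suc u)) where
  field
    Carrier  : Set u
    IsOpen   : Pred (Pred Carrier u) (suc u)
    IsOpen-≐ : IsOpen Respects _≐_
    U-open   : IsOpen U
    ∩-open   : ∀ {A B} → IsOpen A → IsOpen B → IsOpen (A ∩ B)
    ⋃-open   : ∀ {I : Set u} {A : I → Pred Carrier u} →
               (∀ i → IsOpen (A i)) → IsOpen (⋃ I A)

  IsOpenLocalBasis : Carrier → {I : Set u} → (I → Pred Carrier u) → Set (suc u)
  IsOpenLocalBasis x A =
    (∀ i → IsOpen (A i) × x ∈ A i) × (∀ {V} → IsOpen V → x ∈ V → ∃[ i ] A i ⊆ V)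

data GeneratedOpen {X I : Set u} (B : I → Pred X u) : Pred (Pred X u) (suc u) where
  generator : ∀ i → GeneratedOpen B (B i)
  resp-≐    : ∀ {V W} → V ≐ W → GeneratedOpen B V → GeneratedOpen B W
  whole     : GeneratedOpen B U
  inter     : ∀ {V W} → GeneratedOpen B V → GeneratedOpen B W → GeneratedOpen B (V ∩ W)
  union     : ∀ {J : Set u} {V : J → Pred X u} →
              (∀ j → GeneratedOpen B (V j)) → GeneratedOpen B (⋃ J V)

generatedTopology : {X I : Set u} → (I → Pred X u) → TopologicalSpace u
generatedTopology {X = X} B = record
  { Carrier  = X
  ; IsOpen   = GeneratedOpen B
  ; IsOpen-≐ = resp-≐
  ; U-open   = whole
  ; ∩-open   = inter
  ; ⋃-open   = union
  }

-- Λ ^ κ is the set of sequences in Λ of length κ, and Λ ^< κ the set of those of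
-- length < κ (not ordinal exponentiation); Λ stands for the cardinal λ.

infix 7 _^_ _^<_

_^_ : Ordinal u → Ordinal u → Set u
Λ ^ κ = ∣ κ ∣ → ∣ Λ ∣

_^<_ : Ordinal u → Ordinal u → Set u
Λ ^< κ = Σ[ α ∈ ∣ κ ∣ ] Λ ^ (κ ↾ α)

cone : (κ Λ : Ordinal u) → Λ ^< κ → Pred (Λ ^ κ) u
cone κ Λ (α , s) x = ∀ (ξ : ∣ κ ↾ α ∣) → x (value ξ) ≡ s ξ

boundedTopology : Ordinal u → Ordinal u → TopologicalSpace u
boundedTopology κ Λ = generatedTopology (cone κ Λ)

-- The size bound λ enters through injections into Λ: a set has size ≤ λ, and
-- an ordinal is < λ⁺, when it injects into Λ.

record WeaklyMeasurable (Λ : Ordinal u) (X : TopologicalSpace u) : Set (suc (suc u)) where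
  open TopologicalSpace X
  field
    𝔐        : Pred (Pred Carrier u) (suc u)
    𝔐-resp-≐ : 𝔐 Respects _≐_
    𝔐-⋃      : ∀ {I : Set u} {A : I → Pred Carrier u} →
               I ↣ ∣ Λ ∣ → (∀ i → A i ∈ 𝔐) → ⋃ I A ∈ 𝔐
    open⊆𝔐   : IsOpen ⊆ 𝔐

  ∅∈𝔐 : ∅ ∈ 𝔐
  ∅∈𝔐 = 𝔐-resp-≐ ((λ ()) , λ ()) (𝔐-⋃ {I = Empty.⊥} {A = λ ()} ⊥↣ (λ ()))
    where
    ⊥↣ : Empty.⊥ ↣ ∣ Λ ∣
    ⊥↣ = mk↣ {to = λ ()} (λ { {()} })

  U∈𝔐 : U ∈ 𝔐
  U∈𝔐 = open⊆𝔐 U-open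

record WeakMeasureSpace (𝕊 : PositivelyTotallyOrderedMonoid u) (Σ𝕊 : InfinitarySum 𝕊)
                        (Λ : Ordinal u) (X : TopologicalSpace u) : Set (suc (suc u)) where
  open TopologicalSpace X
  private
    module S = PositivelyTotallyOrderedMonoid 𝕊
    module Sum = InfinitarySum Σ𝕊
  field
    weaklyMeasurable : WeaklyMeasurable Λ X
  open WeaklyMeasurable weaklyMeasurable public
  field
    measure : PartialFunction {A = Pred Carrier u} _≐_ S._≈_ (suc u)
  open PartialFunction measure public using () renaming (dom to dom-μ; app to μ)
  field
    𝔐⊆dom : ∀ {A} → A ∈ 𝔐 → A ∈ dom-μ

  μ[_] : ∀ {A} → A ∈ 𝔐 → S.Carrier
  μ[_] {A} A∈𝔐 = μ A (𝔐⊆dom A∈𝔐)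

  field
    μ-∅    : μ[ ∅∈𝔐 ] S.≈ S.0#
    μ-pos  : S.0# S.< μ[ U∈𝔐 ]
    μ-mono : ∀ {A B} (A∈𝔐 : A ∈ 𝔐) (B∈𝔐 : B ∈ 𝔐) → A ⊆ B → μ[ A∈𝔐 ] S.≤ μ[ B∈𝔐 ]
    μ-⋃    : ∀ (Γ : Ordinal u) (Γ↣Λ : ∣ Γ ∣ ↣ ∣ Λ ∣)
             (A : ∣ Γ ∣ → Pred Carrier u) (A∈𝔐 : ∀ i → A i ∈ 𝔐) →
             (∀ {i j} → ¬ (i ≡ j) → A i ⊥ A j) →
             let s = ⟨ Γ , (λ i → μ[ A∈𝔐 i ]) ⟩ in
             Σ[ s∈ ∈ s ∈ Sum.dom ] μ[ 𝔐-⋃ Γ↣Λ A∈𝔐 ] S.≈ Sum.Sum s s∈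
    μ-inf  : ∀ x (x∈𝔐 : ｛ x ｝ ∈ 𝔐) →
             ∀ (Γ : Ordinal u) (Γ↣Λ : ∣ Γ ∣ ↣ ∣ Λ ∣)
             (A : ∣ Γ ∣ → Pred Carrier u) (basis : IsOpenLocalBasis x A) →
             let (A-open , _) = basis in
             S.IsInf (λ i → μ[ open⊆𝔐 (proj₁ (A-open i)) ]) μ[ x∈𝔐 ]

  IsContinuous : Set (suc u)
  IsContinuous = ∀ x → Σ[ x∈𝔐 ∈ ｛ x ｝ ∈ 𝔐 ] μ[ x∈𝔐 ] S.≈ S.0#

{-# OPTIONS --safe #-}

-- Along a limit length a sum of measures is the supremum of its initial sums, and reordering the
-- terms does not change the union; so if at most λ disjoint sets have measure ≤ ε and all finite
-- multiples n · ε are ≤ y, then their union has measure ≤ y (μ-⋃-bounded). With ε = 0 the union V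
-- of all null cones is null. With ε > 0, partitioning the space into shortest cones of measure ≤ ε
-- shows that the values below μ(X) are archimedean.
--
-- Let A be a cone with μ(A) < μ(X). If some non-null cone in A has no two disjoint non-null
-- subcones, then all but one of its points lie in V, so it is null after all. Otherwise repeated
-- splitting yields εₙ > 0 with n · εₙ ≤ μ(A), and these are coinitial among the positive values by
-- the archimedean property. Then for each k only countably many of the shortest cones of measure
-- < εₖ are non-null, and these cones separate the points of A outside V, of which there are
-- therefore at most 2^ℵ₀ ≤ λ. So A is null. Since each point has a neighbourhood of measure < μ(X),
-- the whole space is V, which is null.

module Submission where

open import Defs
open import Algebra.Structures using (IsMonoid)
open import Axiom.ExcludedMiddle using (ExcludedMiddle)
open import Axiom.Extensionality.Propositional using (Extensionality)
open import Data.Bool.Base using (Bool)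
import Data.Empty.Polymorphic as Empty
open import Data.Fin.Base using (Fin; zero; suc; toℕ)
import Data.Fin.Base as Fin
import Data.Fin.Induction as Fin
import Data.Fin.Properties as Fin
open import Data.Irrelevant using ([_])
open import Data.List.Base using (List; []; _∷_; length; lookup)
open import Data.List.Membership.Propositional using () renaming (_∈_ to _∈ˡ_)
open import Data.List.Relation.Unary.Any using (here; there; index)
open import Data.List.Relation.Unary.Any.Properties using (lookup-index)
open import Data.Nat.Base using (ℕ; zero; suc; _*_)
import Data.Nat.Properties as ℕ
open import Data.Product.Base using (Σ-syntax; ∃; ∃-syntax; _×_; _,_; proj₁; proj₂)
open import Data.Refinement using (value; value-injective; _,_)
open import Data.Sum.Base as Sum using (_⊎_; inj₁; inj₂)
open import Function.Base using (_∘_; id)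
open import Function.Bundles using (_↣_; _⤖_; mk↣; Injection; Inverse)
open import Function.Construct.Composition using (_↣-∘_)
open import Function.Properties.Bijection using (⤖⇒↔)
open import Induction.WellFounded using (module All; module Subrelation)
open import Level using (Level; Lift; lift; lower)
open import Relation.Binary.Core using (Rel)
open import Relation.Binary.Definitions using (Trichotomous; tri<; tri≈; tri>)
import Relation.Binary.Construct.On as On
open import Relation.Binary.Morphism.Structures using (IsOrderIsomorphism)
open import Relation.Binary.PropositionalEquality
  using (_≡_; refl; sym; trans; cong; subst; isEquivalence; resp₂)
open import Relation.Binary.Structures using (IsTotalOrder)
open import Relation.Nullary.Decidable.Core using (Dec; yes; no; does; decidable-stable)
open import Relation.Nullary.Negation using (¬_; contradiction)
open import Relation.Nullary.Negation.Core using (contradiction-irr)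
open import Relation.Unary using (Pred; _∈_; _⊆_; _≐_; _∪_; _⊥_; ⋃; ｛_｝)
open import Relation.Unary.Polymorphic using (∅)

private
  variable
    a p q u : Level

-- Coding pairs of natural numbers.

pair : ℕ → ℕ → ℕ
pair zero    n = suc (2 * n)
pair (suc m) n = 2 * pair m n

-- `pair m n` is 2^m (2n + 1): parity separates the cases and halving descends.
pair-injective : ∀ m n m′ n′ → pair m n ≡ pair m′ n′ → m ≡ m′ × n ≡ n′
pair-injective zero    n zero     n′ eq = refl , ℕ.*-cancelˡ-≡ n n′ 2 (ℕ.suc-injective eq)
pair-injective zero    n (suc m′) n′ eq = contradiction (sym eq) (ℕ.even≢odd (pair m′ n′) n)
pair-injective (suc m) n zero     n′ eq = contradiction eq (ℕ.even≢odd (pair m n) n′)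
pair-injective (suc m) n (suc m′) n′ eq
  with pair-injective m n m′ n′ (ℕ.*-cancelˡ-≡ (pair m n) (pair m′ n′) 2 eq)
... | refl , refl = refl , refl

does-transfer : {P : Set p} {Q : Set q} (P? : Dec P) (Q? : Dec Q) → does P? ≡ does Q? → P → Q
does-transfer P?       (yes q) _  _ = q
does-transfer (no ¬p)  (no _)  _  p = contradiction p ¬p
does-transfer (yes _)  (no _)  ()

-- Classical logic and well-orders.

module Classical (em : ∀ {ℓ} → ExcludedMiddle ℓ) where

  byContradiction : {P : Set p} → ¬ ¬ P → P
  byContradiction = decidable-stable em

  ¬∀⇒∃¬ : {A : Set a} {P : A → Set p} → ¬ (∀ x → P x) → ∃[ x ] ¬ P x
  ¬∀⇒∃¬ ¬∀ = byContradiction λ ¬∃ → ¬∀ λ x → byContradiction λ ¬Px → ¬∃ (x , ¬Px)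

  module _ (Γ : Ordinal u) where

    open Ordinal Γ

    least : {P : Carrier → Set p} → ∃ P → ∃[ α ] P α × (∀ β → β < α → ¬ P β)
    least {p = p} {P = P} (α , Pα) = byContradiction λ none →
      All.wfRec wellFounded p (λ β → ¬ P β)
        (λ β below Pβ → none (β , Pβ , λ γ γ<β → below γ<β)) α Pα

    empty∨max∨limit : ¬ Carrier ⊎ (∃[ δ ] ∀ α → α ≤ δ) ⊎ IsLimit Γ
    empty∨max∨limit with em {P = Carrier}
    ... | no empty = inj₁ empty
    ... | yes α₀ with em {P = ∀ α → ∃[ β ] α < β}
    ...   | yes unbounded = inj₂ (inj₂ (α₀ , unbounded))
    ...   | no bounded with ¬∀⇒∃¬ bounded
    ...     | δ , ¬above = inj₂ (inj₁ (δ , below))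
      where
      below : ∀ α → α ≤ δ
      below α with compare α δ
      ... | tri< α<δ _ _ = inj₁ α<δ
      ... | tri≈ _ α≡δ _ = inj₂ α≡δ
      ... | tri> _ _ δ<α = contradiction (α , δ<α) ¬above

module _ (Γ : Ordinal u) where

  open Ordinal Γ

  -- The bound is irrelevant, so it is recovered by deciding the comparison.
  value<bound : {α : Carrier} (β : ∣ Γ ↾ α ∣) → value β < α
  value<bound {α} (β , [ β<α ]) with compare β α
  ... | tri< β<α′ _ _ = β<α′
  ... | tri≈ β≮α _ _ = contradiction-irr β<α β≮α
  ... | tri> β≮α _ _ = contradiction-irr β<α β≮α

  value-↣ : (α : Carrier) → ∣ Γ ↾ α ∣ ↣ Carrier
  value-↣ α = mk↣ {to = value} value-injective

  <-≤-trans : {α β γ : Carrier} → α < β → β ≤ γ → α < γ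
  <-≤-trans α<β (inj₁ β<γ) = Ordinal.trans Γ α<β β<γ
  <-≤-trans α<β (inj₂ refl) = α<β

  ≤-total : (α β : Carrier) → α ≤ β ⊎ β ≤ α
  ≤-total α β with compare α β
  ... | tri< α<β _ _ = inj₁ (inj₁ α<β)
  ... | tri≈ _ α≡β _ = inj₁ (inj₂ α≡β)
  ... | tri> _ _ β<α = inj₂ (inj₁ β<α)

finite : ℕ → Ordinal u
finite {u} n = record
  { Carrier            = Lift u (Fin n)
  ; _<_                = _≺_
  ; isStrictTotalOrder = record
    { isStrictPartialOrder = record
      { isEquivalence = isEquivalence
      ; irrefl        = λ { refl (lift i<i) → Fin.<-irrefl refl i<i }
      ; trans         = λ { (lift i<j) (lift j<k) → lift (Fin.<-trans i<j j<k) }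
      ; <-resp-≈      = resp₂ _≺_
      }
    ; compare = compare
    }
  ; wellFounded = Subrelation.wellFounded lower (On.wellFounded lower Fin.<-wellFounded)
  }
  where
  _≺_ : Rel (Lift u (Fin n)) u
  i ≺ j = Lift u (lower i Fin.< lower j)

  compare : Trichotomous _≡_ _≺_
  compare (lift i) (lift j) with Fin.<-cmp i j
  ... | tri< i<j i≢j i≯j = tri< (lift i<j) (i≢j ∘ cong lower) (i≯j ∘ lower)
  ... | tri≈ i≮j i≡j i≯j = tri≈ (i≮j ∘ lower) (cong lift i≡j) (i≯j ∘ lower)
  ... | tri> i≮j i≢j i>j = tri> (i≮j ∘ lower) (i≢j ∘ cong lower) (lift i>j)

lift-isOrderIsomorphism : (n : ℕ) →
  IsOrderIsomorphism _≡_ _≡_ Fin._<_ (Ordinal._<_ (finite {u} n)) lift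
lift-isOrderIsomorphism n = record
  { isOrderMonomorphism = record
    { isOrderHomomorphism = record { cong = cong lift ; mono = lift }
    ; injective           = cong lower
    ; cancel              = lower
    }
  ; surjective = λ { (lift i) → i , λ { refl → refl } }
  }

id-isOrderIsomorphism : (Γ : Ordinal u) →
  IsOrderIsomorphism _≡_ _≡_ (Ordinal._<_ Γ) (Ordinal._<_ Γ) id
id-isOrderIsomorphism Γ = record
  { isOrderMonomorphism = record
    { isOrderHomomorphism = record { cong = id ; mono = id }
    ; injective           = id
    ; cancel              = id
    }
  ; surjective = λ α → α , id
  }

-- Arithmetic in ordered monoids.

module MonoidProperties (𝕊 : PositivelyTotallyOrderedMonoid u) where

  open PositivelyTotallyOrderedMonoid 𝕊 public using (_≤_; _≈_; _+_; 0#; +-mono-≤; 0-minimum)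
  open PositivelyTotallyOrderedMonoid 𝕊 using (Carrier; isMonoid; isTotalOrder; rawMonoid)
  open IsTotalOrder isTotalOrder public using (total)
    renaming (refl to ≤-refl; trans to ≤-trans; reflexive to ≤-reflexive; antisym to ≤-antisym)
  open IsMonoid isMonoid public using (identityˡ; identityʳ)
    renaming (sym to ≈-sym; trans to ≈-trans; ∙-cong to +-cong; refl to ≈-refl)
  open import Algebra.Definitions.RawMonoid rawMonoid public using () renaming (_×_ to _·_)

  ≰⇒≥ : ∀ {x y} → ¬ (x ≤ y) → y ≤ x
  ≰⇒≥ {x} {y} x≰y with total x y
  ... | inj₁ x≤y = contradiction x≤y x≰y
  ... | inj₂ y≤x = y≤x

  ·-monoʳ-≤ : ∀ n {x y} → x ≤ y → n · x ≤ n · y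
  ·-monoʳ-≤ zero    x≤y = ≤-refl
  ·-monoʳ-≤ (suc n) x≤y = +-mono-≤ x≤y (·-monoʳ-≤ n x≤y)

  ·-zeroʳ-≤ : ∀ n → n · 0# ≤ 0#
  ·-zeroʳ-≤ zero    = ≤-refl
  ·-zeroʳ-≤ (suc n) = ≤-trans (≤-reflexive (identityˡ _)) (·-zeroʳ-≤ n)

  minPositive : ∀ {x y} → ¬ (x ≤ 0#) → ¬ (y ≤ 0#) → ∃[ z ] ¬ (z ≤ 0#) × z ≤ x × z ≤ y
  minPositive {x} {y} x>0 y>0 with total x y
  ... | inj₁ x≤y = x , x>0 , ≤-refl , x≤y
  ... | inj₂ y≤x = y , y>0 , y≤x , ≤-refl

-- Additivity and bounds for measures.

module Measures
  (em : ∀ {ℓ} → ExcludedMiddle ℓ) {Λ : Ordinal u} {X : TopologicalSpace u}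
  {𝕊 : PositivelyTotallyOrderedMonoid u} {Σ𝕊 : InfinitarySum 𝕊}
  (ℕ↣Λ : ℕ ↣ ∣ Λ ∣) (M : WeakMeasureSpace 𝕊 Σ𝕊 Λ X)
  where

  open Classical em
  open MonoidProperties 𝕊
  open PositivelyTotallyOrderedMonoid 𝕊 using (Carrier)
  open InfinitarySum Σ𝕊 using (dom; Sum; app-cong; Sum-finite; Sum-continuous)
  open WeakMeasureSpace M
  open TopologicalSpace X using () renaming (Carrier to Point)

  private
    Set′ : Set _
    Set′ = Pred Point u

    two : Set′ → Set′ → Lift u (Fin 2) → Set′
    two A B (lift zero)    = A
    two A B (lift (suc _)) = B

    two∈𝔐 : {A B : Set′} → A ∈ 𝔐 → B ∈ 𝔐 → ∀ i → two A B i ∈ 𝔐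
    two∈𝔐 a b (lift zero)    = a
    two∈𝔐 a b (lift (suc _)) = b

    2↣Λ : Lift u (Fin 2) ↣ ∣ Λ ∣
    2↣Λ = ℕ↣Λ ↣-∘ mk↣ {to = toℕ ∘ lower} λ eq → cong lift (Fin.toℕ-injective eq)

    ⋃-two : {A B : Set′} → ⋃ (Lift u (Fin 2)) (two A B) ≐ A ∪ B
    ⋃-two = (λ { (lift zero , x∈A) → inj₁ x∈A ; (lift (suc _) , x∈B) → inj₂ x∈B })
           , (λ { (inj₁ x∈A) → lift zero , x∈A ; (inj₂ x∈B) → lift (suc zero) , x∈B })

  ∪∈𝔐 : {A B : Set′} → A ∈ 𝔐 → B ∈ 𝔐 → A ∪ B ∈ 𝔐
  ∪∈𝔐 a b = 𝔐-resp-≐ ⋃-two (𝔐-⋃ 2↣Λ (two∈𝔐 a b))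

  μ-∪ : {A B : Set′} (a : A ∈ 𝔐) (b : B ∈ 𝔐) → A ⊥ B →
        μ[ ∪∈𝔐 a b ] ≈ μ[ a ] + μ[ b ]
  μ-∪ {A} {B} a b A⊥B with μ-⋃ (finite 2) 2↣Λ (two A B) (two∈𝔐 a b) disjoint
    where
    disjoint : ∀ {i j} → ¬ (i ≡ j) → two A B i ⊥ two A B j
    disjoint {lift zero}       {lift zero}       i≢j = contradiction refl i≢j
    disjoint {lift zero}       {lift (suc zero)} _   = A⊥B
    disjoint {lift (suc zero)} {lift zero}       _   = λ (x∈B , x∈A) → A⊥B (x∈A , x∈B)
    disjoint {lift (suc zero)} {lift (suc zero)} i≢j = contradiction refl i≢j
  ... | s∈ , μ≈Sum =
    ≈-trans (≤-antisym (μ-mono _ _ (proj₂ ⋃-two)) (μ-mono _ _ (proj₁ ⋃-two)))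
    (≈-trans μ≈Sum
    -- Length 2 is `n = 1` here; `sum` ends in `+ 0#`, which `identityʳ` removes.
    (≈-trans (Sum-finite _ s∈ 1 lift (lift-isOrderIsomorphism 2))
    (+-cong ≈-refl (identityʳ _))))

  -- (M4) puts every initial segment in the domain of `Sum`, so continuity of the sum applies.
  μ-⋃-limit : (Δ : Ordinal u) (Δ↣Λ : ∣ Δ ∣ ↣ ∣ Λ ∣) → IsLimit Δ →
              {A : ∣ Δ ∣ → Set′} (a : ∀ i → A i ∈ 𝔐) → (∀ {i j} → ¬ (i ≡ j) → A i ⊥ A j) →
              ∀ {y} → (∀ β → μ[ 𝔐-⋃ (Δ↣Λ ↣-∘ value-↣ Δ β) (a ∘ value) ] ≤ y) →
              μ[ 𝔐-⋃ Δ↣Λ a ] ≤ y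
  μ-⋃-limit Δ Δ↣Λ limit {A} a disjoint {y} initial≤y with μ-⋃ Δ Δ↣Λ A a disjoint
  ... | s∈ , μ≈Sum = ≤-trans (≤-reflexive μ≈Sum) (proj₂ isSup y bound)
    where
    s : OrdinalSequence 𝕊
    s = ⟨ Δ , (λ i → μ[ a i ]) ⟩

    initial : ∀ β → Σ[ r∈ ∈ dom (restrict 𝕊 s β) ]
              μ[ 𝔐-⋃ (Δ↣Λ ↣-∘ value-↣ Δ β) (a ∘ value) ] ≈ Sum (restrict 𝕊 s β) r∈
    initial β = μ-⋃ (Δ ↾ β) (Δ↣Λ ↣-∘ value-↣ Δ β) (A ∘ value) (a ∘ value)
                  λ i≢j → disjoint (i≢j ∘ value-injective)

    isSup = Sum-continuous s s∈ limit λ β → (β , proj₁ (initial β)) , inj₂ refl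

    bound : (i : Σ[ β ∈ ∣ Δ ∣ ] dom (restrict 𝕊 s β)) → Sum (restrict 𝕊 s (proj₁ i)) (proj₂ i) ≤ y
    bound (β , r∈) with initial β
    ... | r∈′ , μ≈ = ≤-trans (≤-reflexive (≈-trans
            (app-cong r∈ r∈′ (id , id-isOrderIsomorphism (Δ ↾ β) , λ _ → ≈-refl)) (≈-sym μ≈)))
            (initial≤y β)

  -- Addition need not be continuous, so a last term cannot be split off an infinite sum;
  -- the auxiliary set B collects such terms, to be placed at the front.
  private
    below : (Δ : Ordinal u) → (∣ Δ ∣ → Set′) → ∣ Δ ∣ → Set′
    below Δ A β = ⋃ ∣ Δ ↾ β ∣ (A ∘ value)

    Bounded : Carrier → Carrier → Set′ → Set _
    Bounded ε y E = ∀ n {B C : Set′} (b : B ∈ 𝔐) (c : C ∈ 𝔐) →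
                    B ⊥ E → C ⊆ B ∪ E → μ[ b ] ≤ n · ε → μ[ c ] ≤ y

    Bounded-resp-≐ : ∀ {ε y E E′} → E ≐ E′ → Bounded ε y E → Bounded ε y E′
    Bounded-resp-≐ (E⊆E′ , E′⊆E) bounded n b c B⊥E′ C⊆B∪E′ =
      bounded n b c (λ (x∈B , x∈E) → B⊥E′ (x∈B , E⊆E′ x∈E))
        (λ x∈C → Sum.map₂ E′⊆E (C⊆B∪E′ x∈C))

    module _ {ε y : Carrier} (nε≤y : ∀ n → n · ε ≤ y) where

      -- An empty union leaves only `B`, a last term moves into `B`, and at a limit `B` is merged
      -- into one term so that continuity applies.
      Bounded-step : (Δ : Ordinal u) (Δ↣Λ : ∣ Δ ∣ ↣ ∣ Λ ∣)
        {A : ∣ Δ ∣ → Set′} (a : ∀ i → A i ∈ 𝔐) → (∀ {i j} → ¬ (i ≡ j) → A i ⊥ A j) →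
        (∀ i → μ[ a i ] ≤ ε) →
        (∀ β → Bounded ε y (below Δ A β)) → Bounded ε y (⋃ ∣ Δ ∣ A)
      Bounded-step Δ Δ↣Λ {A} a disjoint a≤ε ih n {B} {C} b c B⊥⋃A C⊆ b≤nε
        with empty∨max∨limit Δ
      ... | inj₁ empty =
        ≤-trans (μ-mono c b λ x∈C → ∈B (C⊆ x∈C)) (≤-trans b≤nε (nε≤y n))
        where
        ∈B : ∀ {x} → x ∈ B ∪ ⋃ ∣ Δ ∣ A → x ∈ B
        ∈B (inj₁ x∈B)     = x∈B
        ∈B (inj₂ (i , _)) = contradiction i empty
      ... | inj₂ (inj₁ (δ , max)) =
        -- `A δ` joins `B` at the cost of one more `ε`, on the left because `suc n · ε` unfolds to
        -- `ε + n · ε`.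
        ih δ (suc n) (∪∈𝔐 (a δ) b) c apart (λ x∈C → rearrange (C⊆ x∈C))
          (≤-trans (≤-reflexive (μ-∪ (a δ) b λ (x∈A , x∈B) → B⊥⋃A (x∈B , δ , x∈A)))
                   (+-mono-≤ (a≤ε δ) b≤nε))
        where
        apart : (A δ ∪ B) ⊥ below Δ A δ
        apart (inj₁ x∈Aδ , i , x∈Ai) =
          disjoint (λ δ≡i → Ordinal.irrefl Δ (sym δ≡i) (value<bound Δ i)) (x∈Aδ , x∈Ai)
        apart (inj₂ x∈B , i , x∈Ai) = B⊥⋃A (x∈B , value i , x∈Ai)

        rearrange : ∀ {x} → x ∈ B ∪ ⋃ ∣ Δ ∣ A → x ∈ (A δ ∪ B) ∪ below Δ A δ
        rearrange (inj₁ x∈B) = inj₁ (inj₂ x∈B)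
        rearrange (inj₂ (i , x∈Ai)) with max i
        ... | inj₁ i<δ  = inj₂ ((i , [ i<δ ]) , x∈Ai)
        ... | inj₂ refl = inj₁ (inj₁ x∈Ai)
      ... | inj₂ (inj₂ limit@(z , _)) =
        -- Initial unions of `A′` lie in `B` plus initial unions of `A`, so `ih` bounds them with
        -- the same `n`.
        ≤-trans (μ-mono c (𝔐-⋃ Δ↣Λ a′) (λ x∈C → absorb (C⊆ x∈C)))
          (μ-⋃-limit Δ Δ↣Λ limit a′ disjoint′ λ β → ih β n b _ (apart β) (release β) b≤nε)
        where
        A′ : ∣ Δ ∣ → Set′
        A′ i x = i ≡ z × x ∈ B ⊎ x ∈ A i

        a′ : ∀ i → A′ i ∈ 𝔐
        a′ i with em {P = i ≡ z}
        ... | yes i≡z = 𝔐-resp-≐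
          ( (λ { (inj₁ x∈B) → inj₁ (i≡z , x∈B) ; (inj₂ x∈Ai) → inj₂ x∈Ai })
          , (λ { (inj₁ (_ , x∈B)) → inj₁ x∈B ; (inj₂ x∈Ai) → inj₂ x∈Ai })) (∪∈𝔐 b (a i))
        ... | no i≢z = 𝔐-resp-≐
          (inj₂ , λ { (inj₁ (i≡z , _)) → contradiction i≡z i≢z ; (inj₂ x∈Ai) → x∈Ai }) (a i)

        disjoint′ : ∀ {i j} → ¬ (i ≡ j) → A′ i ⊥ A′ j
        disjoint′ i≢j (inj₁ (refl , _)   , inj₁ (refl , _))   = i≢j refl
        disjoint′ i≢j (inj₁ (_ , x∈B)    , inj₂ x∈Aj)         = B⊥⋃A (x∈B , _ , x∈Aj)
        disjoint′ i≢j (inj₂ x∈Ai         , inj₁ (_ , x∈B))    = B⊥⋃A (x∈B , _ , x∈Ai)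
        disjoint′ i≢j (inj₂ x∈Ai         , inj₂ x∈Aj)         = disjoint i≢j (x∈Ai , x∈Aj)

        absorb : ∀ {x} → x ∈ B ∪ ⋃ ∣ Δ ∣ A → x ∈ ⋃ ∣ Δ ∣ A′
        absorb (inj₁ x∈B)        = z , inj₁ (refl , x∈B)
        absorb (inj₂ (i , x∈Ai)) = i , inj₂ x∈Ai

        apart : ∀ β → B ⊥ below Δ A β
        apart β (x∈B , i , x∈Ai) = B⊥⋃A (x∈B , value i , x∈Ai)

        release : ∀ β → below Δ A′ β ⊆ B ∪ below Δ A β
        release β (i , inj₁ (_ , x∈B)) = inj₁ x∈B
        release β (i , inj₂ x∈Ai)      = inj₂ (i , x∈Ai)

  -- Induction over the proper initial segments, then one more step for `Λ` itself, from `B` empty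
  -- and `n = 0`.
  μ-⋃-bounded : {A : ∣ Λ ∣ → Set′} (a : ∀ i → A i ∈ 𝔐) → (∀ {i j} → ¬ (i ≡ j) → A i ⊥ A j) →
                ∀ {ε y} → (∀ n → n · ε ≤ y) → (∀ i → μ[ a i ] ≤ ε) →
                ∀ {C} (c : C ∈ 𝔐) → C ⊆ ⋃ ∣ Λ ∣ A → μ[ c ] ≤ y
  μ-⋃-bounded {A} a disjoint {ε} {y} nε≤y a≤ε c C⊆⋃A =
    Bounded-step nε≤y Λ (mk↣ {to = id} id) a disjoint a≤ε initial
      0 ∅∈𝔐 c (λ { (() , _) }) (λ x∈C → inj₂ (C⊆⋃A x∈C)) (≤-reflexive μ-∅)
    where
    initial : ∀ α → Bounded ε y (below Λ A α)
    initial = All.wfRec (Ordinal.wellFounded Λ) _ _ λ α ih →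
      Bounded-step nε≤y (Λ ↾ α) (value-↣ Λ α) (a ∘ value)
        (λ i≢j → disjoint (i≢j ∘ value-injective)) (a≤ε ∘ value)
        -- A segment of `Λ ↾ α` is one of `Λ`, up to nested bounds.
        λ β → Bounded-resp-≐
          ( (λ (i , x∈Ai) → ((value i , [ Ordinal.trans Λ (value<bound Λ i) (value<bound Λ β) ])
                            , [ value<bound Λ i ]) , x∈Ai)
          , (λ (i , x∈Ai) → (value (value i) , [ value<bound (Λ ↾ α) {α = β} i ]) , x∈Ai))
          (ih {value β} (value<bound Λ β))

  subsingleton-null : (∀ x → Σ[ x∈𝔐 ∈ ｛ x ｝ ∈ 𝔐 ] μ[ x∈𝔐 ] ≈ 0#) →
    {A : Set′} → (∀ {x y} → x ∈ A → y ∈ A → x ≡ y) → Σ[ a ∈ A ∈ 𝔐 ] μ[ a ] ≤ 0#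
  subsingleton-null points-null {A} A-subsingleton with em {P = ∃ A}
  ... | yes (x , x∈A) = A∈𝔐 , ≤-trans (μ-mono A∈𝔐 x∈𝔐 (A-subsingleton x∈A)) (≤-reflexive μx≈0)
    where
    x∈𝔐 = proj₁ (points-null x)
    μx≈0 = proj₂ (points-null x)
    A∈𝔐 : A ∈ 𝔐
    A∈𝔐 = 𝔐-resp-≐ ((λ { refl → x∈A }) , A-subsingleton x∈A) x∈𝔐
  ... | no A-empty = A∈𝔐 , ≤-trans (μ-mono A∈𝔐 ∅∈𝔐 λ x∈A → contradiction (_ , x∈A) A-empty)
                                     (≤-reflexive μ-∅)
    where
    A∈𝔐 : A ∈ 𝔐
    A∈𝔐 = 𝔐-resp-≐ ((λ ()) , λ x∈A → contradiction (_ , x∈A) A-empty) ∅∈𝔐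

  -- Otherwise unlisted large sets could be piled up, each contributing a summand of at least `ε`;
  -- `n` of them inside `C` would give `n · ε ≤ μ[ c ]`.
  finitely-many-large : {I : Set p} {A : I → Set′} (a : ∀ i → A i ∈ 𝔐) →
    (∀ {i j} → ¬ (i ≡ j) → A i ⊥ A j) → {C : Set′} (c : C ∈ 𝔐) → (∀ i → A i ⊆ C) →
    ∀ {ε} n → ¬ (n · ε ≤ μ[ c ]) → ∃[ L ] ∀ i → ε ≤ μ[ a i ] → i ∈ˡ L
  finitely-many-large {I = I} {A} a disjoint c A⊆C {ε} n nε≰μC = byContradiction λ unlisted →
    let (_ , _ , d , D⊆ , nε≤μD) = pile unlisted n in
    nε≰μC (≤-trans nε≤μD (μ-mono d c λ x∈D → A⊆C _ (proj₂ (proj₂ (D⊆ x∈D)))))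
    where
    pile : ¬ (∃[ L ] ∀ i → ε ≤ μ[ a i ] → i ∈ˡ L) → ∀ n →
           Σ[ L ∈ List I ] Σ[ D ∈ Set′ ] Σ[ d ∈ D ∈ 𝔐 ]
           (∀ {x} → x ∈ D → ∃[ i ] i ∈ˡ L × x ∈ A i) × n · ε ≤ μ[ d ]
    pile unlisted zero = [] , ∅ , ∅∈𝔐 , (λ ()) , 0-minimum _
    pile unlisted (suc n) with pile unlisted n
    ... | L , D , d , D⊆ , nε≤μD with ¬∀⇒∃¬ (λ listed → unlisted (L , listed))
    ...   | i , ¬listed with em {P = i ∈ˡ L}
    ...     | yes i∈L = contradiction (λ _ → i∈L) ¬listed
    ...     | no i∉L = i ∷ L , A i ∪ D , ∪∈𝔐 (a i) d , A∪D⊆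
                     , ≤-trans (+-mono-≤ ε≤μA nε≤μD) (≤-reflexive (≈-sym (μ-∪ (a i) d apart)))
      where
      ε≤μA : ε ≤ μ[ a i ]
      ε≤μA = byContradiction λ ε≰μA → ¬listed λ ε≤μA → contradiction ε≤μA ε≰μA

      A∪D⊆ : ∀ {x} → x ∈ A i ∪ D → ∃[ j ] j ∈ˡ (i ∷ L) × x ∈ A j
      A∪D⊆ (inj₁ x∈Ai) = i , here refl , x∈Ai
      A∪D⊆ (inj₂ x∈D) with D⊆ x∈D
      ... | j , j∈L , x∈Aj = j , there j∈L , x∈Aj

      apart : A i ⊥ D
      apart (x∈Ai , x∈D) with D⊆ x∈D
      ... | j , j∈L , x∈Aj = disjoint (λ { refl → i∉L j∈L }) (x∈Ai , x∈Aj)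

-- Cones and neighbourhoods.

module Cones
  (em : ∀ {ℓ} → ExcludedMiddle ℓ) (ext : ∀ {a b} → Extensionality a b)
  (κ Λ : Ordinal u) (α₀ : ∣ κ ∣) (ℕ↣Λ : ℕ ↣ ∣ Λ ∣) (κ↣Λ : ∣ κ ∣ ↣ ∣ Λ ∣)
  (nodes : (Λ ^< κ) ⤖ ∣ Λ ∣)
  {𝕊 : PositivelyTotallyOrderedMonoid u} {Σ𝕊 : InfinitarySum 𝕊}
  (M : WeakMeasureSpace 𝕊 Σ𝕊 Λ (boundedTopology κ Λ))
  (continuous : WeakMeasureSpace.IsContinuous M)
  where

  open Classical em
  open MonoidProperties 𝕊
  open PositivelyTotallyOrderedMonoid 𝕊 using (Carrier)
  open WeakMeasureSpace M
  open Measures em ℕ↣Λ M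
  open Ordinal κ using (_<_) renaming (_≤_ to _≤κ_)

  Node : Set u
  Node = Λ ^< κ

  N : Node → Pred (Λ ^ κ) u
  N = cone κ Λ

  N∈𝔐 : ∀ t → N t ∈ 𝔐
  N∈𝔐 t = open⊆𝔐 (generator t)

  ν : Node → Carrier
  ν t = μ[ N∈𝔐 t ]

  ν-mono : ∀ {s t} → N s ⊆ N t → ν s ≤ ν t
  ν-mono = μ-mono (N∈𝔐 _) (N∈𝔐 _)

  Null : Pred Node u
  Null t = ν t ≤ 0#

  prefix : Λ ^ κ → ∣ κ ∣ → Node
  prefix x α = α , x ∘ value

  ∈N⇒prefix : ∀ {x t} → x ∈ N t → t ≡ prefix x (proj₁ t)
  ∈N⇒prefix x∈Nt = cong (_ ,_) (ext λ ξ → sym (x∈Nt ξ))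

  prefix-anti : ∀ {x α β} → α ≤κ β → N (prefix x β) ⊆ N (prefix x α)
  prefix-anti α≤β y∈N ξ = y∈N (value ξ , [ <-≤-trans κ (value<bound κ ξ) α≤β ])

  prefix-cong : ∀ {x y t β} → x ∈ N t → y ∈ N t → β ≤κ proj₁ t → prefix x β ≡ prefix y β
  prefix-cong {x} {y} {t} {β} x∈Nt y∈Nt β≤t =
    cong (β ,_) (ext λ ξ → let ξ′ = value ξ , [ <-≤-trans κ (value<bound κ ξ) β≤t ] in
                           trans (x∈Nt ξ′) (sym (y∈Nt ξ′)))

  N-prefix⊆ : ∀ {x t α} → x ∈ N t → proj₁ t ≤κ α → N (prefix x α) ⊆ N t
  N-prefix⊆ {x} {t} {α} x∈Nt t≤α =
    subst (λ s → N (prefix x α) ⊆ N s) (sym (∈N⇒prefix x∈Nt)) (prefix-anti t≤α)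

  upperBound : ∀ α β → ∃[ γ ] α ≤κ γ × β ≤κ γ
  upperBound α β with ≤-total κ α β
  ... | inj₁ α≤β = β , α≤β , inj₂ refl
  ... | inj₂ β≤α = α , inj₂ refl , β≤α

  -- Prefix cones around `x` form a chain, so at an intersection the longer prefix serves both sets.
  neighbourhood : ∀ {V x} → GeneratedOpen N V → x ∈ V → ∃[ α ] N (prefix x α) ⊆ V
  neighbourhood (generator t) x∈V = proj₁ t , N-prefix⊆ x∈V (inj₂ refl)
  neighbourhood (resp-≐ (V⊆W , W⊆V) V-open) x∈W with neighbourhood V-open (W⊆V x∈W)
  ... | α , N⊆V = α , λ y∈N → V⊆W (N⊆V y∈N)
  neighbourhood whole _ = α₀ , _
  neighbourhood (inter V-open W-open) (x∈V , x∈W)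
    with neighbourhood V-open x∈V | neighbourhood W-open x∈W
  ... | α , N⊆V | β , N⊆W with upperBound α β
  ...   | γ , α≤γ , β≤γ = γ , λ y∈N → N⊆V (prefix-anti α≤γ y∈N) , N⊆W (prefix-anti β≤γ y∈N)
  neighbourhood (union V-open) (j , x∈V) with neighbourhood (V-open j) x∈V
  ... | α , N⊆V = α , λ y∈N → j , N⊆V y∈N

  -- Prefix cones around `x` form a local basis of size at most λ, so by (M5) their measures have
  -- infimum 0 and `ε` is no lower bound.
  shrink : ∀ x {ε} → ¬ (ε ≤ 0#) → ∃[ α ] ¬ (ε ≤ ν (prefix x α))
  shrink x {ε} ε>0 = ¬∀⇒∃¬ λ ε≤ν →
    ε>0 (≤-trans (proj₂ (μ-inf x x∈𝔐 κ κ↣Λ (N ∘ prefix x) basis) ε ε≤ν) (≤-reflexive μx≈0))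
    where
    x∈𝔐 = proj₁ (continuous x)
    μx≈0 = proj₂ (continuous x)

    basis : TopologicalSpace.IsOpenLocalBasis (boundedTopology κ Λ) x (N ∘ prefix x)
    basis = (λ α → generator (prefix x α) , λ ξ → refl) , neighbourhood

  -- Partition into shortest cones.

  module _ (Q : Pred Node u) where

    Reached : Pred (Λ ^ κ) u
    Reached x = ∃[ α ] Q (prefix x α)

    -- The cone of t when t is a shortest node in Q, and empty otherwise.
    Hit : Node → Pred (Λ ^ κ) u
    Hit t x = Q t × x ∈ N t × (∀ β → β < proj₁ t → ¬ Q (prefix x β))

    -- Minimality of `t` only concerns shorter prefixes, which all points of `N t` share. Hence
    -- `Hit t` is `N t` or empty, and so measurable.
    Hit-saturated : ∀ {t x} → x ∈ Hit t → N t ⊆ Hit t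
    Hit-saturated {t} (Qt , x∈Nt , first) y∈Nt =
      Qt , y∈Nt , λ β β<t Qβ → first β β<t (subst Q (prefix-cong {t = t} y∈Nt x∈Nt (inj₁ β<t)) Qβ)

    Hit⊆N : ∀ {t} → Hit t ⊆ N t
    Hit⊆N (_ , x∈Nt , _) = x∈Nt

    Hit∈𝔐 : ∀ t → Hit t ∈ 𝔐
    Hit∈𝔐 t with em {P = ∃ (Hit t)}
    ... | yes (x , x∈Hit) = 𝔐-resp-≐ (Hit-saturated x∈Hit , Hit⊆N) (N∈𝔐 t)
    ... | no empty = 𝔐-resp-≐ ((λ ()) , λ x∈Hit → contradiction (_ , x∈Hit) empty) ∅∈𝔐

    -- Both nodes would be prefixes of a common point, and only one prefix can be the shortest in
    -- `Q`.
    Hit-disjoint : ∀ {s t} → ¬ (s ≡ t) → Hit s ⊥ Hit t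
    Hit-disjoint {s} {t} s≢t {x} ((Qs , x∈Ns , s-first) , (Qt , x∈Nt , t-first))
      with Ordinal.compare κ (proj₁ s) (proj₁ t)
    ... | tri< s<t _ _ = t-first _ s<t (subst Q (∈N⇒prefix x∈Ns) Qs)
    ... | tri≈ _ s≡t _ =
      s≢t (trans (∈N⇒prefix x∈Ns) (trans (cong (prefix x) s≡t) (sym (∈N⇒prefix x∈Nt))))
    ... | tri> _ _ t<s = s-first _ t<s (subst Q (∈N⇒prefix x∈Nt) Qt)

    Reached⇒Hit : ∀ {x} → x ∈ Reached → ∃[ α ] x ∈ Hit (prefix x α)
    Reached⇒Hit x∈R with least κ x∈R
    ... | α , Qα , first = α , Qα , (λ ξ → refl) , first

    private
      open Inverse (⤖⇒↔ nodes) using (to; from; strictlyInverseʳ; strictlyInverseˡ)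

      Reached⊆⋃ : Reached ⊆ ⋃ ∣ Λ ∣ (Hit ∘ from)
      Reached⊆⋃ {x} x∈R with Reached⇒Hit x∈R
      ... | α , x∈Hit = to (prefix x α) ,
                        subst (λ t → x ∈ Hit t) (sym (strictlyInverseʳ (prefix x α))) x∈Hit

    Reached∈𝔐 : Reached ∈ 𝔐
    Reached∈𝔐 = 𝔐-resp-≐ (⋃⊆ , Reached⊆⋃) (𝔐-⋃ (mk↣ {to = id} id) (Hit∈𝔐 ∘ from))
      where
      ⋃⊆ : ⋃ ∣ Λ ∣ (Hit ∘ from) ⊆ Reached
      ⋃⊆ (i , Qt , x∈Nt , _) = proj₁ (from i) , subst Q (∈N⇒prefix x∈Nt) Qt

    -- The hits, indexed by `Λ` through `nodes`, split `Reached` into disjoint pieces of measure at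
    -- most `ε`.
    μ-Reached : ∀ {ε y} → (∀ n → n · ε ≤ y) → (∀ {t} → Q t → ν t ≤ ε) →
                ∀ {C} (c : C ∈ 𝔐) → C ⊆ Reached → μ[ c ] ≤ y
    μ-Reached {ε} nε≤y Q⇒ν≤ε c C⊆R =
      μ-⋃-bounded (Hit∈𝔐 ∘ from) (λ i≢j → Hit-disjoint λ eq → i≢j
          (trans (sym (strictlyInverseˡ _)) (trans (cong to eq) (strictlyInverseˡ _))))
        nε≤y hit≤ε c (λ x∈C → Reached⊆⋃ (C⊆R x∈C))
      where
      hit≤ε : ∀ i → μ[ Hit∈𝔐 (from i) ] ≤ ε
      hit≤ε i with em {P = Q (from i)}
      ... | yes Qt = ≤-trans (μ-mono _ (N∈𝔐 (from i)) Hit⊆N) (Q⇒ν≤ε Qt)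
      ... | no ¬Qt = ≤-trans (μ-mono _ ∅∈𝔐 λ (Qt , _) → contradiction Qt ¬Qt)
                             (≤-trans (≤-reflexive μ-∅) (0-minimum ε))

  -- The null part of the space.

  V : Pred (Λ ^ κ) u
  V = Reached Null

  μV≤0 : μ[ Reached∈𝔐 Null ] ≤ 0#
  μV≤0 = μ-Reached Null ·-zeroʳ-≤ id (Reached∈𝔐 Null) id

  -- Outside `V` the cone falls into fibres of `f`: at most λ disjoint sets with at most one point
  -- each, hence null together.
  null-outside-few-points : ∀ s (f : Λ ^ κ → ∣ Λ ∣) →
    (∀ {x y} → x ∈ N s → ¬ x ∈ V → y ∈ N s → ¬ y ∈ V → f x ≡ f y → x ≡ y) → Null s
  null-outside-few-points s f f-injective =
    ≤-trans (μ-mono (N∈𝔐 s) (∪∈𝔐 v r) cover)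
    (≤-trans (≤-reflexive (μ-∪ v r λ (x∈V , _ , _ , x∉V , _) → x∉V x∈V))
    (≤-trans (+-mono-≤ μV≤0 r≤0) (≤-reflexive (identityˡ 0#))))
    where
    R : ∣ Λ ∣ → Pred (Λ ^ κ) u
    R i x = x ∈ N s × ¬ x ∈ V × f x ≡ i

    R-null : ∀ i → Σ[ a ∈ R i ∈ 𝔐 ] μ[ a ] ≤ 0#
    R-null i = subsingleton-null continuous λ (x∈N , x∉V , fx≡i) (y∈N , y∉V , fy≡i) →
      f-injective x∈N x∉V y∈N y∉V (trans fx≡i (sym fy≡i))

    v = Reached∈𝔐 Null
    r = 𝔐-⋃ (mk↣ {to = id} id) (proj₁ ∘ R-null)

    r≤0 : μ[ r ] ≤ 0#
    r≤0 = μ-⋃-bounded (proj₁ ∘ R-null)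
      (λ i≢j ((_ , _ , fx≡i) , (_ , _ , fx≡j)) → i≢j (trans (sym fx≡i) fx≡j))
      ·-zeroʳ-≤ (proj₂ ∘ R-null) r id

    cover : N s ⊆ V ∪ ⋃ ∣ Λ ∣ R
    cover {x} x∈N with em {P = x ∈ V}
    ... | yes x∈V = inj₁ x∈V
    ... | no x∉V  = inj₂ (f x , x∈N , x∉V , refl)

  -- If every `n · ε` were at most `y`, then, since cones of measure at most `ε` cover the space,
  -- `μ-Reached` would give `μ[ U∈𝔐 ] ≤ y`.
  archimedean : ∀ {y} → ¬ (μ[ U∈𝔐 ] ≤ y) → ∀ {ε} → ¬ (ε ≤ 0#) → ∃[ n ] ¬ (n · ε ≤ y)
  archimedean {y} μU≰y {ε} ε>0 = ¬∀⇒∃¬ λ nε≤y →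
    μU≰y (μ-Reached (λ t → ν t ≤ ε) nε≤y id U∈𝔐 λ {x} _ →
      let (α , ε≰ν) = shrink x ε>0 in α , ≰⇒≥ ε≰ν)

  -- Splitting cones and coding points by bits.

  Splits : Pred Node u
  Splits s = ∃[ t₁ ] ∃[ t₂ ] ¬ Null t₁ × ¬ Null t₂ × N t₁ ⊆ N s × N t₂ ⊆ N s × N t₁ ⊥ N t₂

  -- Two points outside `V` would split `s`: their prefixes beyond a difference are disjoint, and
  -- non-null by choice of the points.
  ¬Splits⇒Null : (∀ ξ → ∃[ α ] ξ < α) → ∀ {s} → ¬ Splits s → Null s
  -- With at most one point left, a constant map separates.
  ¬Splits⇒Null unbounded {s} ¬splits = null-outside-few-points s (λ _ → Injection.to κ↣Λ α₀)
    λ {x} {y} x∈N x∉V y∈N y∉V _ → byContradiction λ x≢y →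
      let (ξ , xξ≢yξ)     = ¬∀⇒∃¬ (x≢y ∘ ext)
          (α , ξ<α)       = unbounded ξ
          (β , α≤β , s≤β) = upperBound α (proj₁ s)
          ξ′              = ξ , [ <-≤-trans κ ξ<α α≤β ]
      in ¬splits ( prefix x β , prefix y β , (λ null → x∉V (β , null)) , (λ null → y∉V (β , null))
                 , N-prefix⊆ {t = s} x∈N s≤β , N-prefix⊆ {t = s} y∈N s≤β
                 , λ (z∈Nx , z∈Ny) → xξ≢yξ (trans (sym (z∈Nx ξ′)) (z∈Ny ξ′)))

  -- `t₁` carries `n` summands by induction and `t₂` one more; the smaller of the two bounds serves
  -- throughout.
  multiples-below : ∀ {s} → (∀ t → N t ⊆ N s → ¬ Null t → Splits t) →
    ∀ n t → N t ⊆ N s → ¬ Null t → ∃[ ε ] ¬ (ε ≤ 0#) × n · ε ≤ ν t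
  multiples-below splits zero t Nt⊆Ns t>0 = ν t , t>0 , 0-minimum _
  multiples-below splits (suc n) t Nt⊆Ns t>0 with splits t Nt⊆Ns t>0
  ... | t₁ , t₂ , t₁>0 , t₂>0 , N₁⊆Nt , N₂⊆Nt , N₁⊥N₂
    with multiples-below splits n t₁ (λ x∈N → Nt⊆Ns (N₁⊆Nt x∈N)) t₁>0
  ... | ε , ε>0 , nε≤ν₁ with minPositive t₂>0 ε>0
  ... | δ , δ>0 , δ≤ν₂ , δ≤ε = δ , δ>0 ,
    ≤-trans (+-mono-≤ δ≤ν₂ (≤-trans (·-monoʳ-≤ n δ≤ε) nε≤ν₁))
    (≤-trans (≤-reflexive (≈-sym (μ-∪ (N∈𝔐 t₂) (N∈𝔐 t₁) λ (x∈N₂ , x∈N₁) → N₁⊥N₂ (x∈N₁ , x∈N₂))))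
             (μ-mono _ (N∈𝔐 t) λ { (inj₁ x∈N₂) → N₂⊆Nt x∈N₂ ; (inj₂ x∈N₁) → N₁⊆Nt x∈N₁ }))

  -- The points outside `V` are separated by which cones of the lists `L k m` contain them. These
  -- lists are finite by `arch`, so countably many bits suffice.
  countably-coinitial⇒Null : (ℕ → Bool) ↣ ∣ Λ ∣ → ∀ s →
    (∀ {ε} → ¬ (ε ≤ 0#) → ∃[ n ] ¬ (n · ε ≤ ν s)) →
    (ε : ℕ → Carrier) → (∀ k → ¬ (ε k ≤ 0#)) → (∀ {x} → ¬ (x ≤ 0#) → ∃[ k ] ε k ≤ x) →
    Null s
  countably-coinitial⇒Null 2^ℕ↣Λ s arch ε ε>0 coinitial =
    null-outside-few-points s (Injection.to 2^ℕ↣Λ ∘ code) separated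
    where
    Q : ℕ → Pred Node u
    Q k t = N t ⊆ N s × ¬ (ε k ≤ ν t)

    listing : ∀ k m → ∃[ L ] ∀ t → ε m ≤ μ[ Hit∈𝔐 (Q k) t ] → t ∈ˡ L
    listing k m = let (n , nε≰ν) = arch (ε>0 m) in
      finitely-many-large (Hit∈𝔐 (Q k)) (Hit-disjoint (Q k)) (N∈𝔐 s)
        (λ t ((Nt⊆Ns , _) , x∈Nt , _) → Nt⊆Ns x∈Nt) n nε≰ν

    L : ℕ → ℕ → List Node
    L k m = proj₁ (listing k m)

    -- `pair` flattens all lists into one enumeration; bit `j` asks whether the cone numbered `j`,
    -- if any, contains `x`.
    Coded : Λ ^ κ → ℕ → Set u
    Coded x j = ∃[ k ] ∃[ m ] Σ[ i ∈ Fin (length (L k m)) ]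
                pair k (pair m (toℕ i)) ≡ j × x ∈ N (lookup (L k m) i)

    code : Λ ^ κ → ℕ → Bool
    code x j = does (em {P = Coded x j})

    listed-transfer : ∀ {x y k m t} → code x ≡ code y → t ∈ˡ L k m → x ∈ N t → y ∈ N t
    listed-transfer {x} {y} {k} {m} {t} same t∈L x∈Nt
      with does-transfer (em {P = Coded x j}) (em {P = Coded y j}) (cong (λ c → c j) same)
             (k , m , index t∈L , refl , subst (λ t → x ∈ N t) (lookup-index t∈L) x∈Nt)
      where j = pair k (pair m (toℕ (index t∈L)))
    ... | k′ , m′ , i , eq , y∈N
      with pair-injective k′ (pair m′ (toℕ i)) k (pair m (toℕ (index t∈L))) eq
    ... | refl , eq′ with pair-injective m′ (toℕ i) m (toℕ (index t∈L)) eq′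
    ... | refl , i≡ with Fin.toℕ-injective i≡
    ... | refl = subst (λ t → y ∈ N t) (sym (lookup-index t∈L)) y∈N

    separated : ∀ {x y} → x ∈ N s → ¬ x ∈ V → y ∈ N s → ¬ y ∈ V →
                Injection.to 2^ℕ↣Λ (code x) ≡ Injection.to 2^ℕ↣Λ (code y) → x ≡ y
    separated {x} {y} x∈Ns x∉V _ _ same = byContradiction λ x≢y →
      let (ξ , xξ≢yξ) = ¬∀⇒∃¬ (x≢y ∘ ext)
          (k , ε≤ν)   = coinitial λ null → x∉V (ξ , null)
      in small ξ xξ≢yξ k ε≤ν
      where
      reached : ∀ k → x ∈ Reached (Q k)
      reached k =
        let (α , ε≰ν)       = shrink x (ε>0 k)
            (β , α≤β , s≤β) = upperBound α (proj₁ s)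
        in β , N-prefix⊆ {t = s} x∈Ns s≤β , λ ε≤ν → ε≰ν (≤-trans ε≤ν (ν-mono (prefix-anti α≤β)))

      small : ∀ ξ → ¬ (x ξ ≡ y ξ) → ∀ k → ¬ (ε k ≤ ν (prefix x ξ))
      small ξ xξ≢yξ k ε≤ν with Reached⇒Hit (Q k) (reached k)
      ... | α , hit@((_ , ε≰ν) , _) with ≤-total κ α ξ
      -- A hit cone no longer than `ξ` would contain `N (prefix x ξ)`, so its measure would be at
      -- least `ε k`.
      ...   | inj₁ α≤ξ = ε≰ν (≤-trans ε≤ν (ν-mono (prefix-anti α≤ξ)))
      ...   | inj₂ (inj₂ refl) = ε≰ν ε≤ν
      ...   | inj₂ (inj₁ ξ<α) =
        -- This cone extends past `ξ` and is non-null as `x` is outside `V`, so it is listed. Equal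
        -- codes put `y` in it, forcing agreement at `ξ`.
        let (m , ε≤) = coinitial λ null → x∉V (α , null)
            t∈L      = proj₂ (listing k m) (prefix x α)
                         (≤-trans ε≤ (μ-mono _ _ (Hit-saturated (Q k) hit)))
            y∈N      = listed-transfer (Injection.injective 2^ℕ↣Λ same) t∈L (λ _ → refl)
        in xξ≢yξ (sym (y∈N (ξ , [ ξ<α ])))

  -- Nullity of small cones and the contradiction.

  small-cone-null : (∀ ξ → ∃[ α ] ξ < α) → (ℕ → Bool) ↣ ∣ Λ ∣ →
                    ∀ {s} → ¬ (μ[ U∈𝔐 ] ≤ ν s) → Null s
  small-cone-null unbounded 2^ℕ↣Λ {s} μU≰ν = byContradiction λ s>0 →
    let multiples = λ n → multiples-below splits n s id s>0
        ε         = proj₁ ∘ multiples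
    in s>0 (countably-coinitial⇒Null 2^ℕ↣Λ s (archimedean μU≰ν) ε (proj₁ ∘ proj₂ ∘ multiples)
         -- `x ≤ ε n` would give `n · x ≤ n · ε n ≤ ν s`, against the choice of `n`.
         λ {x} x>0 → let (n , nx≰ν) = archimedean μU≰ν x>0 in
           n , ≰⇒≥ λ x≤ε → nx≰ν (≤-trans (·-monoʳ-≤ n x≤ε) (proj₂ (proj₂ (multiples n)))))
    where
    splits : ∀ t → N t ⊆ N s → ¬ Null t → Splits t
    splits t _ t>0 = byContradiction λ ¬splits → t>0 (¬Splits⇒Null unbounded ¬splits)

  -- Taking `ε` to be the measure of the whole space in `shrink` puts every point in a cone of
  -- smaller measure, which is null. So `V` is everything.
  no-continuous-measure : (∀ ξ → ∃[ α ] ξ < α) → ¬ ((ℕ → Bool) ↣ ∣ Λ ∣)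
  no-continuous-measure unbounded 2^ℕ↣Λ = μU≰0 (≤-trans (μ-mono U∈𝔐 (Reached∈𝔐 Null) λ {x} _ →
      let (α , μU≰ν) = shrink x μU≰0 in α , small-cone-null unbounded 2^ℕ↣Λ μU≰ν) μV≤0)
    where
    μU≰0 : ¬ (μ[ U∈𝔐 ] ≤ 0#)
    μU≰0 μU≤0 = proj₂ μ-pos (≤-antisym (0-minimum _) μU≤0)

-- The constant map to a maximum `δ` would be cofinal from a shorter ordinal.
regular-unbounded : (κ : Ordinal u) → ℕ ↣ ∣ κ ∣ → IsRegular κ → ¬ (∃[ δ ] ∀ α → Ordinal._≤_ κ α δ)
regular-unbounded κ ℕ↣κ regular (δ , max) = regular δ (λ _ → δ) λ α → below-δ , max α
  where
  open Injection ℕ↣κ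

  below-δ : ∣ κ ↾ δ ∣
  -- The images of 0 and 1 differ, so one of them lies below `δ`.
  below-δ with max (to 0) | max (to 1)
  ... | inj₁ 0<δ | _        = to 0 , [ 0<δ ]
  ... | inj₂ _   | inj₁ 1<δ = to 1 , [ 1<δ ]
  ... | inj₂ 0≡δ | inj₂ 1≡δ = contradiction (injective (trans 0≡δ (sym 1≡δ))) λ ()

corollary8p1 : (∀ {ℓ} → ExcludedMiddle ℓ) →
    (∀ {a b} → Extensionality a b) →
    ∀ {u} (κ Λ : Ordinal u) →
    IsInfiniteCardinal κ →
    IsInfiniteCardinal Λ →
    ∣ κ ∣ ↣ ∣ Λ ∣ →
    IsRegular κ →
    (Λ ^< κ) ⤖ ∣ Λ ∣ →
    (ℕ → Bool) ↣ ∣ Λ ∣ →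
    (𝕊 : PositivelyTotallyOrderedMonoid u) (Σ𝕊 : InfinitarySum 𝕊) →
    ¬ (Σ[ M ∈ WeakMeasureSpace 𝕊 Σ𝕊 Λ (boundedTopology κ Λ) ] WeakMeasureSpace.IsContinuous M)
corollary8p1 em ext κ Λ (ℕ↣κ , _) (ℕ↣Λ , _) κ↣Λ regular nodes 2^ℕ↣Λ 𝕊 Σ𝕊 (M , continuous) =
  Cones.no-continuous-measure em ext κ Λ α₀ ℕ↣Λ κ↣Λ nodes M continuous unbounded 2^ℕ↣Λ
  where
  α₀ = Injection.to ℕ↣κ 0

  unbounded : ∀ ξ → ∃[ α ] Ordinal._<_ κ ξ α
  unbounded with Classical.empty∨max∨limit em κ
  ... | inj₁ empty              = contradiction α₀ empty
  ... | inj₂ (inj₁ max)         = contradiction max (regular-unbounded κ ℕ↣κ regular)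
  ... | inj₂ (inj₂ (_ , limit)) = limit
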